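{- The function $m:\mathbb{R}\to\mathbb{R}$ does not satisfy the recursive formula $$m(x)=\begin{cases}-x & \text{if } x<0,\\ \tfrac12\, m\bigl(x-m(x-1)\bigr) & \text{if } x\ge 0;\end{cases}$$ that is, it is not the case that this identity holds for all $x\in\mathbb{R}$.
   Context: The fuse operation is the partial binary operation on real numbers $a\sim b=(a+b+1)/2$, applicable only when $|a-b|<1$. A fusible number is a real number obtainable from $0$ by finitely many (valid) applications of the fuse operation; i.e. the set $\mathcal{F}$ of fusible numbers is the smallest subset of $\mathbb{R}$ such that $0\in\mathcal{F}$ and, whenever $a,b\in\mathcal{F}$ and $|a-b|<1$, also $(a+b+1)/2\in\mathcal{F}$. The set $\mathcal{F}$ is well-ordered by the usual order of $\mathbb{R}$. For $a\in\mathbb{R}$ define $s(a)=\min\{b\in\mathcal{F}: b>a\}$ and $m(a)=s(a)-a$. -}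

module Defs where

open import Data.Nat.Base as ℕ using (ℕ)
import Data.Nat.Properties as ℕ
open import Data.Product.Base using (Σ-syntax; ∃-syntax; _×_; _,_)
open import Data.Rational.Base as ℚ using (ℚ; 0ℚ; 1ℚ; ½)
import Data.Rational.Properties as ℚ
open import Data.Rational.Solver using (module +-*-Solver)
open import Data.Sum.Base using (inj₁; inj₂)
open import Relation.Binary.PropositionalEquality
  using (_≡_; refl; sym; trans; cong; subst)
open import Relation.Nullary.Negation using (¬_)

private
  -- Rearrangements of rational differences, used for the Cauchy conditions.

  diff-+ : ∀ a b c d → (a ℚ.+ b) ℚ.- (c ℚ.+ d) ≡ (a ℚ.- c) ℚ.+ (b ℚ.- d)
  diff-+ = solve 4 (λ a b c d →
      (a :+ b) :+ (:- (c :+ d)) := (a :+ (:- c)) :+ (b :+ (:- d))) refl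
    where open +-*-Solver

  diff-neg : ∀ a b → (ℚ.- a) ℚ.- (ℚ.- b) ≡ ℚ.- (a ℚ.- b)
  diff-neg = solve 2 (λ a b →
      (:- a) :+ (:- (:- b)) := :- (a :+ (:- b))) refl
    where open +-*-Solver

  diff-½ : ∀ a b → ½ ℚ.* a ℚ.- ½ ℚ.* b ≡ ½ ℚ.* (a ℚ.- b)
  diff-½ = solve 2 (λ a b →
      con ½ :* a :+ (:- (con ½ :* b)) := con ½ :* (a :+ (:- b))) refl
    where open +-*-Solver

  sub-add : ∀ a b → (a ℚ.- b) ℚ.+ b ≡ a
  sub-add = solve 2 (λ a b → (a :+ (:- b)) :+ b := a) refl
    where open +-*-Solver

  add-sub : ∀ a b → (a ℚ.+ b) ℚ.- b ≡ a
  add-sub = solve 2 (λ a b → (a :+ b) :+ (:- b) := a) refl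
    where open +-*-Solver

  neg-sub : ∀ a b → ℚ.- (a ℚ.- b) ≡ b ℚ.- a
  neg-sub = solve 2 (λ a b → :- (a :+ (:- b)) := b :+ (:- a)) refl
    where open +-*-Solver

  halves : ∀ a → ½ ℚ.* a ℚ.+ ½ ℚ.* a ≡ a
  halves a = trans (sym (ℚ.*-distribʳ-+ a ½ ½)) (ℚ.*-identityˡ a)

  ½-pos : ∀ {ε} → 0ℚ ℚ.< ε → 0ℚ ℚ.< ½ ℚ.* ε
  ½-pos 0<ε = ℚ.*-monoʳ-<-pos ½ 0<ε

  ∣x-y∣≡∣y-x∣ : ∀ a b → ℚ.∣ a ℚ.- b ∣ ≡ ℚ.∣ b ℚ.- a ∣
  ∣x-y∣≡∣y-x∣ a b =
    trans (sym (ℚ.∣-p∣≡∣p∣ (a ℚ.- b))) (cong ℚ.∣_∣ (neg-sub a b))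

  ∣a∣-∣b∣≤∣a-b∣ : ∀ a b → ℚ.∣ a ∣ ℚ.- ℚ.∣ b ∣ ℚ.≤ ℚ.∣ a ℚ.- b ∣
  ∣a∣-∣b∣≤∣a-b∣ a b = begin
    ℚ.∣ a ∣ ℚ.- ℚ.∣ b ∣                        ≡⟨ cong (λ t → ℚ.∣ t ∣ ℚ.- ℚ.∣ b ∣) (sub-add a b) ⟨
    ℚ.∣ (a ℚ.- b) ℚ.+ b ∣ ℚ.- ℚ.∣ b ∣          ≤⟨ ℚ.+-monoˡ-≤ (ℚ.- ℚ.∣ b ∣) (ℚ.∣p+q∣≤∣p∣+∣q∣ (a ℚ.- b) b) ⟩
    (ℚ.∣ a ℚ.- b ∣ ℚ.+ ℚ.∣ b ∣) ℚ.- ℚ.∣ b ∣    ≡⟨ add-sub ℚ.∣ a ℚ.- b ∣ ℚ.∣ b ∣ ⟩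
    ℚ.∣ a ℚ.- b ∣                              ∎
    where open ℚ.≤-Reasoning

  ∣∣a∣-∣b∣∣≤∣a-b∣ : ∀ a b → ℚ.∣ ℚ.∣ a ∣ ℚ.- ℚ.∣ b ∣ ∣ ℚ.≤ ℚ.∣ a ℚ.- b ∣
  ∣∣a∣-∣b∣∣≤∣a-b∣ a b with ℚ.∣p∣≡p∨∣p∣≡-p (ℚ.∣ a ∣ ℚ.- ℚ.∣ b ∣)
  ... | inj₁ eq = subst (ℚ._≤ ℚ.∣ a ℚ.- b ∣) (sym eq) (∣a∣-∣b∣≤∣a-b∣ a b)
  ... | inj₂ eq = begin
    ℚ.∣ ℚ.∣ a ∣ ℚ.- ℚ.∣ b ∣ ∣  ≡⟨ trans eq (neg-sub ℚ.∣ a ∣ ℚ.∣ b ∣) ⟩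
    ℚ.∣ b ∣ ℚ.- ℚ.∣ a ∣        ≤⟨ ∣a∣-∣b∣≤∣a-b∣ b a ⟩
    ℚ.∣ b ℚ.- a ∣              ≡⟨ ∣x-y∣≡∣y-x∣ b a ⟩
    ℚ.∣ a ℚ.- b ∣              ∎
    where open ℚ.≤-Reasoning

IsCauchy : (ℕ → ℚ) → Set
IsCauchy u = ∀ ε → 0ℚ ℚ.< ε →
  ∃[ N ] (∀ m n → N ℕ.≤ m → N ℕ.≤ n → ℚ.∣ u m ℚ.- u n ∣ ℚ.< ε)

-- The real numbers, as Cauchy sequences of rationals; equality of reals is
-- the equivalence relation _≈_ below, not propositional equality.
record ℝ : Set where
  constructor mkℝ
  field
    seq    : ℕ → ℚ
    cauchy : IsCauchy seq

open ℝ public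

infix  4 _≈_ _<_ _≤_
infixl 6 _+_ _-_
infix  8 -_
infixl 9 _/2

_≈_ : ℝ → ℝ → Set
x ≈ y = ∀ ε → 0ℚ ℚ.< ε →
  ∃[ N ] (∀ n → N ℕ.≤ n → ℚ.∣ seq x n ℚ.- seq y n ∣ ℚ.< ε)

_<_ : ℝ → ℝ → Set
x < y = Σ[ ε ∈ ℚ ] (0ℚ ℚ.< ε ×
  ∃[ N ] (∀ n → N ℕ.≤ n → seq x n ℚ.+ ε ℚ.≤ seq y n))

_≤_ : ℝ → ℝ → Set
x ≤ y = ¬ (y < x)

fromℚ : ℚ → ℝ
fromℚ q = mkℝ (λ _ → q) λ ε 0<ε → 0 , λ _ _ _ _ →
  subst (λ t → ℚ.∣ t ∣ ℚ.< ε) (sym (ℚ.+-inverseʳ q)) 0<ε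

0ℝ : ℝ
0ℝ = fromℚ 0ℚ

1ℝ : ℝ
1ℝ = fromℚ 1ℚ

_+_ : ℝ → ℝ → ℝ
x + y = mkℝ (λ n → seq x n ℚ.+ seq y n) λ ε 0<ε →
  let (M , p) = cauchy x (½ ℚ.* ε) (½-pos 0<ε)
      (N , q) = cauchy y (½ ℚ.* ε) (½-pos 0<ε)
  in M ℕ.⊔ N , λ m n hm hn → let open ℚ.≤-Reasoning in begin-strict
    ℚ.∣ (seq x m ℚ.+ seq y m) ℚ.- (seq x n ℚ.+ seq y n) ∣
      ≡⟨ cong ℚ.∣_∣ (diff-+ (seq x m) (seq y m) (seq x n) (seq y n)) ⟩
    ℚ.∣ (seq x m ℚ.- seq x n) ℚ.+ (seq y m ℚ.- seq y n) ∣
      ≤⟨ ℚ.∣p+q∣≤∣p∣+∣q∣ (seq x m ℚ.- seq x n) (seq y m ℚ.- seq y n) ⟩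
    ℚ.∣ seq x m ℚ.- seq x n ∣ ℚ.+ ℚ.∣ seq y m ℚ.- seq y n ∣
      <⟨ ℚ.+-mono-< (p m n (ℕ.m⊔n≤o⇒m≤o M N hm) (ℕ.m⊔n≤o⇒m≤o M N hn))
                    (q m n (ℕ.m⊔n≤o⇒n≤o M N hm) (ℕ.m⊔n≤o⇒n≤o M N hn)) ⟩
    ½ ℚ.* ε ℚ.+ ½ ℚ.* ε
      ≡⟨ halves ε ⟩
    ε ∎

-_ : ℝ → ℝ
- x = mkℝ (λ n → ℚ.- seq x n) λ ε 0<ε →
  let (N , p) = cauchy x ε 0<ε
  in N , λ m n hm hn → subst (ℚ._< ε)
       (sym (trans (cong ℚ.∣_∣ (diff-neg (seq x m) (seq x n)))
                   (ℚ.∣-p∣≡∣p∣ (seq x m ℚ.- seq x n))))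
       (p m n hm hn)

_-_ : ℝ → ℝ → ℝ
x - y = x + (- y)

_/2 : ℝ → ℝ
x /2 = mkℝ (λ n → ½ ℚ.* seq x n) λ ε 0<ε →
  let (N , p) = cauchy x (ε ℚ.+ ε) (ℚ.+-mono-< 0<ε 0<ε)
  in N , λ m n hm hn → let open ℚ.≤-Reasoning in begin-strict
    ℚ.∣ ½ ℚ.* seq x m ℚ.- ½ ℚ.* seq x n ∣
      ≡⟨ cong ℚ.∣_∣ (diff-½ (seq x m) (seq x n)) ⟩
    ℚ.∣ ½ ℚ.* (seq x m ℚ.- seq x n) ∣
      ≡⟨ ℚ.∣p*q∣≡∣p∣*∣q∣ ½ (seq x m ℚ.- seq x n) ⟩
    ½ ℚ.* ℚ.∣ seq x m ℚ.- seq x n ∣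
      <⟨ ℚ.*-monoʳ-<-pos ½ (p m n hm hn) ⟩
    ½ ℚ.* (ε ℚ.+ ε)
      ≡⟨ ℚ.*-distribˡ-+ ½ ε ε ⟩
    ½ ℚ.* ε ℚ.+ ½ ℚ.* ε
      ≡⟨ halves ε ⟩
    ε ∎

∣_∣ : ℝ → ℝ
∣ x ∣ = mkℝ (λ n → ℚ.∣ seq x n ∣) λ ε 0<ε →
  let (N , p) = cauchy x ε 0<ε
  in N , λ m n hm hn →
       ℚ.≤-<-trans (∣∣a∣-∣b∣∣≤∣a-b∣ (seq x m) (seq x n)) (p m n hm hn)

infix 5 _∼_

_∼_ : ℝ → ℝ → ℝ
a ∼ b = (a + b + 1ℝ) /2

-- Membership is stated up to _≈_, so that this is a subset of the reals and
-- not merely of the Cauchy sequences representing them.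
data Fusible : ℝ → Set where
  zero : ∀ {x} → x ≈ 0ℝ → Fusible x
  fuse : ∀ {x a b} → Fusible a → Fusible b → ∣ a - b ∣ < 1ℝ →
         x ≈ a ∼ b → Fusible x

_IsMinimumOf_ : ℝ → (ℝ → Set) → Set
b IsMinimumOf P = P b × (∀ c → P c → b ≤ c)

-- The functions s and m are given by their graphs, since the minimum defining
-- s cannot be computed from a Cauchy sequence: s[ a ]= b means s(a) = b, and
-- m[ a ]= y means m(a) = y.
s[_]=_ : ℝ → ℝ → Set
s[ a ]= b = b IsMinimumOf (λ c → Fusible c × a < c)

m[_]=_ : ℝ → ℝ → Set
m[ a ]= y = Σ[ b ∈ ℝ ] (s[ a ]= b × y ≈ b - a)

{-# OPTIONS --safe #-}

-- The formula determines m at every point from which its recursion reaches the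
-- negative numbers. It yields m(17/16) = 1/16 and m(2) = 1/1024, hence
-- m(33/16) = m(2)/2 = 1/2048. But 8449/4096 = 33/16 + 1/4096 is fusible, as
-- 19/16 ∼ 3969/2048, so the true value of m(33/16) is at most 1/4096.
module Submission where

open import Defs
open import Data.Integer.Base using (+_; -[1+_])
import Data.Nat.Properties as ℕ
open import Data.Product.Base using (_×_; _,_; proj₁; proj₂)
open import Data.Rational.Base as ℚ using (ℚ; 0ℚ; 1ℚ; ½; _/_)
import Data.Rational.Properties as ℚ
open import Data.Rational.Solver using (module +-*-Solver)
open import Data.Sum.Base using (inj₁; inj₂)
open import Relation.Binary.PropositionalEquality using (_≡_; refl; sym; subst; subst₂)
open import Relation.Nullary.Decidable using (True; toWitness; from-no)
open import Relation.Nullary.Negation using (¬_)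

p<q⇒0<q-p : ∀ {p q} → p ℚ.< q → 0ℚ ℚ.< q ℚ.- p
p<q⇒0<q-p {p} {q} p<q =
  subst (ℚ._< q ℚ.- p) (ℚ.+-inverseʳ p) (ℚ.+-monoˡ-< (ℚ.- p) p<q)

p+[q-p]≡q : ∀ p q → p ℚ.+ (q ℚ.- p) ≡ q
p+[q-p]≡q = solve 2 (λ p q → p :+ (q :+ (:- p)) := q) refl
  where open +-*-Solver

p≤∣p∣ : ∀ p → p ℚ.≤ ℚ.∣ p ∣
p≤∣p∣ p with ℚ.≤-total 0ℚ p
... | inj₁ 0≤p = ℚ.≤-reflexive (sym (ℚ.0≤p⇒∣p∣≡p 0≤p))
... | inj₂ p≤0 = ℚ.≤-trans p≤0 (ℚ.0≤∣p∣ p)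

fromℚ-mono-< : ∀ {p q} → p ℚ.< q → fromℚ p < fromℚ q
fromℚ-mono-< {p} {q} p<q =
  q ℚ.- p , p<q⇒0<q-p p<q , 0 , λ _ _ → ℚ.≤-reflexive (p+[q-p]≡q p q)

fromℚ-cancel-< : ∀ {p q} → fromℚ p < fromℚ q → p ℚ.< q
fromℚ-cancel-< {p} {q} (ε , 0<ε , N , p+ε≤q) =
  ℚ.<-≤-trans (subst (ℚ._< p ℚ.+ ε) (ℚ.+-identityʳ p) (ℚ.+-monoʳ-< p 0<ε))
              (p+ε≤q N ℕ.≤-refl)

fromℚ-mono-≤ : ∀ {p q} → p ℚ.≤ q → fromℚ p ≤ fromℚ q
fromℚ-mono-≤ p≤q q<p = ℚ.<-irrefl refl (ℚ.<-≤-trans (fromℚ-cancel-< q<p) p≤q)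

≈-refl : ∀ x → x ≈ x
≈-refl x ε 0<ε = 0 , λ n _ →
  subst (λ t → ℚ.∣ t ∣ ℚ.< ε) (sym (ℚ.+-inverseʳ (seq x n))) 0<ε

Fusibleℚ : ℚ → Set
Fusibleℚ p = Fusible (fromℚ p)

-- At constant sequences `_∼_` computes termwise and `_≈_` ignores the Cauchy proofs, so reflexivity
-- suffices; the side condition is decided by evaluation.
fuseℚ : ∀ {a b} → Fusibleℚ a → Fusibleℚ b → {True (ℚ.∣ a ℚ.- b ∣ ℚ.<? 1ℚ)} →
        Fusibleℚ (½ ℚ.* (a ℚ.+ b ℚ.+ 1ℚ))
fuseℚ {a} {b} fa fb {∣a-b∣<1} =
  fuse fa fb (fromℚ-mono-< (toWitness ∣a-b∣<1)) (≈-refl (fromℚ a ∼ fromℚ b))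

-- A record, so that unification recovers p and u from the type.
record mℚ (p u : ℚ) : Set where
  constructor mkmℚ
  field
    graph : m[ fromℚ p ]= fromℚ u

-- The least fusible `b` above `p` is p + u only up to `_≈_`. If q < p + u, a rational `r` strictly
-- between them makes q < b, against the minimality of `b`.
mℚ⇒p+u≤q : ∀ {p u q} → mℚ p u → Fusibleℚ q → p ℚ.< q → p ℚ.+ u ℚ.≤ q
mℚ⇒p+u≤q {p} {u} {q} (mkmℚ (b , (_ , b-least) , u≈b-p)) fq p<q = ℚ.≮⇒≥ λ q<p+u →
  let (r , q<r , r<p+u) = ℚ.<-dense q<p+u
      -- This tolerance is the gap from `r` to p + u, so eventually the terms of `b` exceed `r`.
      (N , close)       = u≈b-p (p ℚ.+ u ℚ.- r) (p<q⇒0<q-p r<p+u)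
      r<b n N≤n = subst₂ ℚ._<_ (shiftˡ p u r (seq b n)) (shiftʳ p u r (seq b n))
        (ℚ.+-monoˡ-< (r ℚ.+ seq b n ℚ.- (p ℚ.+ u))
          (ℚ.≤-<-trans (p≤∣p∣ (u ℚ.- (seq b n ℚ.- p))) (close n N≤n)))
  in b-least (fromℚ q) (fq , fromℚ-mono-< p<q)
       (r ℚ.- q , p<q⇒0<q-p q<r , N , λ n N≤n →
         ℚ.≤-trans (ℚ.≤-reflexive (p+[q-p]≡q q r)) (ℚ.<⇒≤ (r<b n N≤n)))
  where
  open +-*-Solver
  shiftˡ : ∀ p u r b → (u ℚ.- (b ℚ.- p)) ℚ.+ (r ℚ.+ b ℚ.- (p ℚ.+ u)) ≡ r
  shiftˡ = solve 4 (λ p u r b →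
    (u :+ (:- (b :+ (:- p)))) :+ (r :+ b :+ (:- (p :+ u))) := r) refl
  shiftʳ : ∀ p u r b → (p ℚ.+ u ℚ.- r) ℚ.+ (r ℚ.+ b ℚ.- (p ℚ.+ u)) ≡ b
  shiftʳ = solve 4 (λ p u r b →
    (p :+ u :+ (:- r)) :+ (r :+ b :+ (:- (p :+ u))) := b) refl

Fusible-8449/4096 : Fusibleℚ (+ 8449 / 4096)
Fusible-8449/4096 = fuseℚ f19/16 f3969/2048
  where
  f0 : Fusibleℚ 0ℚ
  f0 = zero (≈-refl 0ℝ)
  -- Fusing with 0 halves the distance to 1.
  f1/2 : Fusibleℚ ½
  f1/2 = fuseℚ f0 f0
  f3/4 : Fusibleℚ (+ 3 / 4)
  f3/4 = fuseℚ f0 f1/2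
  f7/8 : Fusibleℚ (+ 7 / 8)
  f7/8 = fuseℚ f0 f3/4
  f15/16 : Fusibleℚ (+ 15 / 16)
  f15/16 = fuseℚ f0 f7/8
  f31/32 : Fusibleℚ (+ 31 / 32)
  f31/32 = fuseℚ f0 f15/16
  f63/64 : Fusibleℚ (+ 63 / 64)
  f63/64 = fuseℚ f0 f31/32
  f19/16 : Fusibleℚ (+ 19 / 16)
  f19/16 = fuseℚ f1/2 f7/8
  f159/128 : Fusibleℚ (+ 159 / 128)
  f159/128 = fuseℚ f1/2 f63/64
  -- Fusing with 63/64 halves the distance to 127/64: it goes from 95/128 down to 95/2048.
  f413/256 : Fusibleℚ (+ 413 / 256)
  f413/256 = fuseℚ f63/64 f159/128
  f921/512 : Fusibleℚ (+ 921 / 512)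
  f921/512 = fuseℚ f63/64 f413/256
  f1937/1024 : Fusibleℚ (+ 1937 / 1024)
  f1937/1024 = fuseℚ f63/64 f921/512
  f3969/2048 : Fusibleℚ (+ 3969 / 2048)
  f3969/2048 = fuseℚ f63/64 f1937/1024

-- The claim to be refuted, named so that a module can assume it. Since m is a graph, `u` and `v`
-- stand for the inner and outer values in the nested term m(x - m(x - 1)).
RecursiveFormula : Set
RecursiveFormula = (x : ℝ) →
    (x < 0ℝ → m[ x ]= (- x))
  × (0ℝ ≤ x → (u v : ℝ) → m[ x - 1ℝ ]= u → m[ x - u ]= v → m[ x ]= (v /2))

-- m[ x ]= y depends on x and y only through their sequences, so the arithmetic
-- of reals in the formula is definitionally that of ℚ at rational points.
module _ (formula : RecursiveFormula) where

  neg : ∀ {p} → {True (p ℚ.<? 0ℚ)} → mℚ p (ℚ.- p)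
  neg {p} {p<0} =
    mkmℚ (proj₁ (formula (fromℚ p)) (fromℚ-mono-< (toWitness p<0)))

  rec : ∀ {p u v} → {True (0ℚ ℚ.≤? p)} →
        mℚ (p ℚ.- 1ℚ) u → mℚ (p ℚ.- u) v → mℚ p (½ ℚ.* v)
  rec {p} {u} {v} {0≤p} (mkmℚ mu) (mkmℚ mv) = mkmℚ (proj₂ (formula (fromℚ p))
    (fromℚ-mono-≤ (toWitness 0≤p)) (fromℚ u) (fromℚ v) mu mv)

  m1/16 : mℚ (+ 1 / 16) (+ 7 / 16)
  m1/16 = rec neg neg
  m1/4 : mℚ (+ 1 / 4) (+ 1 / 4)
  m1/4 = rec neg neg
  m5/8 : mℚ (+ 5 / 8) (+ 1 / 8)
  m5/8 = rec neg m1/4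
  m17/16 : mℚ (+ 17 / 16) (+ 1 / 16)
  m17/16 = rec m1/16 m5/8
  m0 : mℚ (+ 0 / 1) (+ 1 / 2)
  m0 = rec neg neg
  m1/2 : mℚ (+ 1 / 2) (+ 1 / 4)
  m1/2 = rec neg m0
  m1 : mℚ (+ 1 / 1) (+ 1 / 8)
  m1 = rec m0 m1/2
  m3/4 : mℚ (+ 3 / 4) (+ 1 / 8)
  m3/4 = rec neg m1/2
  m7/8 : mℚ (+ 7 / 8) (+ 1 / 16)
  m7/8 = rec neg m3/4
  m13/16 : mℚ (+ 13 / 16) (+ 1 / 16)
  m13/16 = rec neg m5/8
  -- From here to `m2`, subtracting m(p - 1) from p leads to the previous point of 1, 5/4, 3/2,
  -- 13/8, 7/4, 29/16, 15/8, 2. Seven halvings thus take m(1) = 1/8 to 1/1024.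
  m5/4 : mℚ (+ 5 / 4) (+ 1 / 16)
  m5/4 = rec m1/4 m1
  m3/2 : mℚ (+ 3 / 2) (+ 1 / 32)
  m3/2 = rec m1/2 m5/4
  m13/8 : mℚ (+ 13 / 8) (+ 1 / 64)
  m13/8 = rec m5/8 m3/2
  m7/4 : mℚ (+ 7 / 4) (+ 1 / 128)
  m7/4 = rec m3/4 m13/8
  m29/16 : mℚ (+ 29 / 16) (+ 1 / 256)
  m29/16 = rec m13/16 m7/4
  m15/8 : mℚ (+ 15 / 8) (+ 1 / 512)
  m15/8 = rec m7/8 m29/16
  m2 : mℚ (+ 2 / 1) (+ 1 / 1024)
  m2 = rec m1 m15/8
  m33/16 : mℚ (+ 33 / 16) (+ 1 / 2048)
  m33/16 = rec m17/16 m2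

mainTheorem3 : ¬ ((x : ℝ) →
    (x < 0ℝ → m[ x ]= (- x))
    × (0ℝ ≤ x → (u v : ℝ) → m[ x - 1ℝ ]= u → m[ x - u ]= v → m[ x ]= (v /2)))
-- The left side is 8450/4096, too large by 1/4096.
mainTheorem3 formula = from-no (+ 33 / 16 ℚ.+ + 1 / 2048 ℚ.≤? + 8449 / 4096)
  (mℚ⇒p+u≤q (m33/16 formula) Fusible-8449/4096
    (toWitness {a? = + 33 / 16 ℚ.<? + 8449 / 4096} _))
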